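{- Let $\mathrm{a}_{n,k}^{\mathrm{asc}}(123,132)$ denote the number of permutations of $\{1,\dots,n\}$ that avoid both $123$ and $132$ and have exactly $k$ ascents. Then for all integers $n\ge1$ and $k\ge0$, $$\mathrm{a}_{n,k}^{\mathrm{asc}}(123,132)=\binom{n}{2k}.$$
   Context: $\mathcal{S}_n$ is the set of permutations $\pi=\pi_1\cdots\pi_n$ of $\{1,\dots,n\}$. For $\rho\in\mathcal{S}_m$, $\pi\in\mathcal{S}_n$ contains $\rho$ if there are indices $1\le i_1<\cdots<i_m\le n$ such that $\pi_{i_a}<\pi_{i_b}$ if and only if $\rho_a<\rho_b$; otherwise $\pi$ avoids $\rho$. The number of ascents is $\mathrm{asc}(\pi)=|\{i:\pi_i<\pi_{i+1}\}|$, where $1\le i\le n-1$. Binomial coefficients $\binom{m}{j}$ with $j>m\ge 0$ are $0$. -}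

module Defs where

open import Data.Fin using (Fin; suc; inject₁; _<_; _<?_)
open import Data.Fin.Patterns using (0F; 1F; 2F)
open import Data.Fin.Permutation using (Permutation′; _⟨$⟩ʳ_; _≈_; id; transpose)
open import Data.List using ([]; _∷_; allFin; filter; length; map)
open import Data.Nat using (ℕ; zero; suc)
open import Data.Product using (Σ; _×_; ∃; proj₁)
open import Function.Bundles using (_⇔_; Inverse)
open import Level using (Level; 0ℓ; _⊔_)
open import Relation.Binary.Bundles using (Setoid)
import Relation.Binary.Construct.On as On
open import Relation.Binary.Definitions using (Monotonic₁)
open import Relation.Binary.PropositionalEquality using (_≡_; refl; sym; trans; setoid)
open import Relation.Nullary using (¬_)

private
  variable
    m n : ℕ
    a ℓ : Level

-- A permutation of {1,…,n} is a permutation of Fin n: positions and values are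
-- both shifted down by one, which changes neither patterns nor ascents.

Contains : Permutation′ m → Permutation′ n → Set
Contains {m} {n} ρ π = ∃ λ (i : Fin m → Fin n) →
  Monotonic₁ _<_ _<_ i ×
  (∀ a b → (π ⟨$⟩ʳ i a < π ⟨$⟩ʳ i b) ⇔ (ρ ⟨$⟩ʳ a < ρ ⟨$⟩ʳ b))

Avoids : Permutation′ m → Permutation′ n → Set
Avoids ρ π = ¬ Contains ρ π

asc : Permutation′ n → ℕ
asc {zero}  π = 0
asc {suc n} π =
  length (filter (λ i → π ⟨$⟩ʳ inject₁ i <? π ⟨$⟩ʳ suc i) (allFin n))

p123 : Permutation′ 3
p123 = id

p132 : Permutation′ 3
p132 = transpose 1F 2F

_ : map (p132 ⟨$⟩ʳ_) (allFin 3) ≡ 0F ∷ 2F ∷ 1F ∷ []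
_ = refl

-- Permutations are compared by their values: propositional equality of the
-- stdlib record would also compare inverses and proofs.

permutations : ℕ → Setoid 0ℓ 0ℓ
permutations n = record
  { Carrier       = Permutation′ n
  ; _≈_           = _≈_
  ; isEquivalence = record
    { refl  = λ _ → refl
    ; sym   = λ p i → sym (p i)
    ; trans = λ p q i → trans (p i) (q i)
    }
  }

-- { π ∈ Sₙ : π avoids σ and τ, asc π = k }

avoidersWithAsc : Permutation′ m → Permutation′ m → ℕ → ℕ → Setoid 0ℓ 0ℓ
avoidersWithAsc σ τ n k =
  On.setoid {B = Σ (Permutation′ n) λ π → Avoids σ π × Avoids τ π × asc π ≡ k}
            (permutations n) proj₁

HasCardinality : Setoid a ℓ → ℕ → Set (a ⊔ ℓ)
HasCardinality S c = Inverse S (setoid (Fin c))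

{-# OPTIONS --safe #-}

-- A permutation avoids 123 and 132 exactly when every entry has at most one
-- larger entry to its right.  Recording with one bit per position (the last
-- one excepted) whether such an entry exists gives a bijection with all binary
-- words of length n − 1, and the permutation ascends at i exactly when its word,
-- followed by a final 0, has a 1 at i and a 0 at i + 1.  Such a word with k
-- descents 10, padded by a 0 on each side, changes value 2k times, at an
-- arbitrary 2k-subset of the n boundaries.
module Submission where

open import Defs
open import Data.Bool using (Bool; true; false)
open import Data.Empty using (⊥; ⊥-elim)
open import Data.Fin using (Fin; zero; suc; toℕ; fromℕ; inject₁; punchIn; _<_; _<?_; _≟_) renaming (_≤_ to _≤ᶠ_)
open import Data.Fin.Patterns using (0F; 1F; 2F)
open import Data.Fin.Permutation using (Permutation′; _⟨$⟩ʳ_; _⟨$⟩ˡ_; _≈_; id; insert; remove; inverseʳ; punchIn-permute; cast-id)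
open import Data.Fin.Properties using (+↔⊎; <-cmp; <-irrefl; toℕ-fromℕ; toℕ-inject₁; toℕ-injective; toℕ<n; punchIn-mono-≤; punchIn-cancel-≤; punchIn-injective; fromℕ≢inject₁)
open import Data.List using ([]; _∷_; map; filter; length; allFin; tabulate)
open import Data.List.Properties using (filter-≐; filter-accept; filter-reject; map-tabulate)
open import Data.Nat using (ℕ; zero; suc; z≤n; s≤s; s≤s⁻¹; _≤_; _*_)
import Data.Nat as ℕ
open import Data.Nat.Combinatorics using (_C_; nCk+nC[k+1]≡[n+1]C[k+1]; k>n⇒nCk≡0)
import Data.Nat.Properties as ℕ
open import Data.Product using (Σ; ∃; _×_; _,_; proj₁; proj₂; map₂)
open import Data.Sum using (_⊎_; inj₁; inj₂)
open import Data.Sum.Algebra using (⊎-comm)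
open import Data.Sum.Function.Propositional using (_⊎-↔_)
open import Data.Vec using (Vec; []; _∷_)
open import Function using (_∘_; _↔_; mk↔ₛ′; _⇔_; mk⇔; Equivalence; Injection; Inverse)
open import Function.Construct.Composition using (inverse)
open import Function.Properties.Inverse using (↔-sym; ↔-trans; ↔⇒↣)
open import Level using (0ℓ)
open import Relation.Binary.Definitions using (Monotonic₁; tri<; tri≈; tri>)
open import Relation.Binary.PropositionalEquality
open import Relation.Nullary using (¬_; yes; no; contradiction)
open import Relation.Unary using (Pred; Decidable)

private
  variable
    m n k : ℕ
    A B : Set

-- Order properties of `punchIn` and of removing the first entry

⟨$⟩ʳ-injective : (π : Permutation′ n) {i j : Fin n} → π ⟨$⟩ʳ i ≡ π ⟨$⟩ʳ j → i ≡ j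
⟨$⟩ʳ-injective π = Injection.injective (↔⇒↣ π)

punchIn-mono-< : ∀ (v : Fin (suc n)) {i j} → i < j → punchIn v i < punchIn v j
punchIn-mono-< v {i} {j} i<j =
  ℕ.≰⇒> λ le → ℕ.<⇒≱ i<j (punchIn-cancel-≤ v j i le)

punchIn-cancel-< : ∀ (v : Fin (suc n)) {i j} → punchIn v i < punchIn v j → i < j
punchIn-cancel-< v {i} {j} lt =
  ℕ.≰⇒> λ le → ℕ.<⇒≱ lt (punchIn-mono-≤ v j i le)

-- `punchIn v` skips the value `v`, so exactly the indices from `v` on move up by one.
≤⇒<punchIn : ∀ (v : Fin (suc n)) i → v ≤ᶠ i → v < punchIn v i
≤⇒<punchIn zero    i       _         = s≤s z≤n
≤⇒<punchIn (suc v) (suc i) (s≤s v≤i) = s≤s (≤⇒<punchIn v i v≤i)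

<punchIn⇒≤ : ∀ (v : Fin (suc n)) i → v < punchIn v i → v ≤ᶠ i
<punchIn⇒≤ zero    i       _         = z≤n
<punchIn⇒≤ (suc v) (suc i) (s≤s v<i) = s≤s (<punchIn⇒≤ v i v<i)

insert-remove₀ : (π : Permutation′ (suc n)) →
                 insert 0F (π ⟨$⟩ʳ 0F) (remove 0F π) ≈ π
insert-remove₀ π zero    = refl
insert-remove₀ π (suc i) = sym (punchIn-permute π 0F i)

-- Avoidance

-- The entries at `j` and `k` are not compared with each other, which merges 123 and 132 into one
-- condition.
AtMostOneLargerAfter : Permutation′ n → Set
AtMostOneLargerAfter π = ∀ {i j k} → i < j → j < k →
  π ⟨$⟩ʳ i < π ⟨$⟩ʳ j → ¬ π ⟨$⟩ʳ i < π ⟨$⟩ʳ k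

triple : A → A → A → Fin 3 → A
triple x y z 0F = x
triple x y z 1F = y
triple x y z 2F = z

triple-mono : {x y z : Fin n} → x < y → y < z → Monotonic₁ _<_ _<_ (triple x y z)
triple-mono x<y y<z {0F} {1F} _ = x<y
triple-mono x<y y<z {0F} {2F} _ = ℕ.<-trans x<y y<z
triple-mono x<y y<z {1F} {2F} _ = y<z
triple-mono x<y y<z {1F} {1F} (s≤s ())
triple-mono x<y y<z {2F} {1F} (s≤s ())
triple-mono x<y y<z {2F} {2F} (s≤s (s≤s ()))

-- Trichotomy on the values of `ρ` supplies the converse implication: equal values come from equal
-- positions, and a reversed comparison would carry over to `π`.
contains : (ρ : Permutation′ m) (π : Permutation′ n) (i : Fin m → Fin n) →
           Monotonic₁ _<_ _<_ i →
           (∀ a b → ρ ⟨$⟩ʳ a < ρ ⟨$⟩ʳ b → π ⟨$⟩ʳ i a < π ⟨$⟩ʳ i b) →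
           Contains ρ π
contains ρ π i i-mono preserves = i , i-mono , λ a b → mk⇔ (reflects a b) (preserves a b)
  where
  reflects : ∀ a b → π ⟨$⟩ʳ i a < π ⟨$⟩ʳ i b → ρ ⟨$⟩ʳ a < ρ ⟨$⟩ʳ b
  reflects a b lt with <-cmp (ρ ⟨$⟩ʳ a) (ρ ⟨$⟩ʳ b)
  ... | tri< ρa<ρb _ _ = ρa<ρb
  ... | tri≈ _ ρa≡ρb _ = contradiction lt (<-irrefl (cong (λ c → π ⟨$⟩ʳ i c) (⟨$⟩ʳ-injective ρ ρa≡ρb)))
  ... | tri> _ _ ρb<ρa = contradiction lt (ℕ.<-asym (preserves b a ρb<ρa))

-- The order of the two larger entries decides which pattern would occur: 123 if they increase, 132
-- if they decrease.
avoids⇒atMostOneLargerAfter : (π : Permutation′ n) → Avoids p123 π → Avoids p132 π →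
                              AtMostOneLargerAfter π
avoids⇒atMostOneLargerAfter π av123 av132 {i} {j} {k} i<j j<k πi<πj πi<πk
  with <-cmp (π ⟨$⟩ʳ j) (π ⟨$⟩ʳ k)
... | tri< πj<πk _ _ = av123 (contains p123 π (triple i j k) (triple-mono i<j j<k) preserves)
  where
  preserves : ∀ a b → a < b → π ⟨$⟩ʳ triple i j k a < π ⟨$⟩ʳ triple i j k b
  preserves 0F 1F _ = πi<πj
  preserves 0F 2F _ = πi<πk
  preserves 1F 2F _ = πj<πk
  preserves 1F 1F (s≤s ())
  preserves 2F 1F (s≤s ())
  preserves 2F 2F (s≤s (s≤s ()))
... | tri≈ _ πj≡πk _ = <-irrefl (⟨$⟩ʳ-injective π πj≡πk) j<k
... | tri> _ _ πk<πj = av132 (contains p132 π (triple i j k) (triple-mono i<j j<k) preserves)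
  where
  preserves : ∀ a b → p132 ⟨$⟩ʳ a < p132 ⟨$⟩ʳ b →
              π ⟨$⟩ʳ triple i j k a < π ⟨$⟩ʳ triple i j k b
  preserves 0F 1F _ = πi<πj
  preserves 0F 2F _ = πi<πk
  preserves 2F 1F _ = πk<πj
  preserves 1F 1F (s≤s (s≤s ()))
  preserves 1F 2F (s≤s ())
  preserves 2F 2F (s≤s ())

-- Both patterns begin with their least value, so an occurrence of either one shows an entry with
-- two larger entries after it.
atMostOneLargerAfter⇒avoids : (ρ : Permutation′ 3) → ρ ⟨$⟩ʳ 0F < ρ ⟨$⟩ʳ 1F → ρ ⟨$⟩ʳ 0F < ρ ⟨$⟩ʳ 2F →
                              (π : Permutation′ n) → AtMostOneLargerAfter π → Avoids ρ π
atMostOneLargerAfter⇒avoids ρ ρ₀<ρ₁ ρ₀<ρ₂ π few (i , i-mono , iff) =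
  few (i-mono {0F} {1F} (s≤s z≤n)) (i-mono {1F} {2F} (s≤s (s≤s z≤n)))
      (Equivalence.from (iff 0F 1F) ρ₀<ρ₁) (Equivalence.from (iff 0F 2F) ρ₀<ρ₂)

-- Ascents

length-filter-map : {P : Pred A 0ℓ} {Q : Pred B 0ℓ} (P? : Decidable P) (Q? : Decidable Q)
                    (f : B → A) → (∀ x → P (f x) ⇔ Q x) → ∀ xs →
                    length (filter P? (map f xs)) ≡ length (filter Q? xs)
length-filter-map P? Q? f iff []       = refl
length-filter-map P? Q? f iff (x ∷ xs) with Q? x
... | yes q = trans (cong length (filter-accept P? (Equivalence.from (iff x) q)))
                    (cong suc (length-filter-map P? Q? f iff xs))
... | no ¬q = trans (cong length (filter-reject P? (¬q ∘ Equivalence.to (iff x))))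
                    (length-filter-map P? Q? f iff xs)

asc-cong : (π ρ : Permutation′ n) → π ≈ ρ → asc π ≡ asc ρ
asc-cong {zero}  π ρ π≈ρ = refl
asc-cong {suc n} π ρ π≈ρ = cong length (filter-≐ _ _
  ( (λ {i} → subst₂ _<_ (π≈ρ (inject₁ i)) (π≈ρ (suc i)))
  , (λ {i} → subst₂ _<_ (sym (π≈ρ (inject₁ i))) (sym (π≈ρ (suc i)))) ) (allFin n))

module _ (v : Fin (suc (suc n))) (σ : Permutation′ (suc n)) where

  private
    π : Permutation′ (suc (suc n))
    π = insert 0F v σ

    ascent? : Decidable (λ i → π ⟨$⟩ʳ inject₁ i < π ⟨$⟩ʳ suc i)
    ascent? i = π ⟨$⟩ʳ inject₁ i <? π ⟨$⟩ʳ suc i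

    -- `punchIn v` preserves and reflects strict order, so only the comparison at the new front can
    -- change the count.
    later-ascents : length (filter ascent? (tabulate suc)) ≡ asc σ
    later-ascents = trans
      (cong (length ∘ filter ascent?) (sym (map-tabulate (λ i → i) suc)))
      (length-filter-map ascent? _ suc
        (λ i → mk⇔ (punchIn-cancel-< v) (punchIn-mono-< v)) (allFin n))

  asc-insert-ascent : v ≤ᶠ σ ⟨$⟩ʳ 0F → asc (insert 0F v σ) ≡ suc (asc σ)
  asc-insert-ascent v≤σ₀ = trans
    (cong length (filter-accept ascent? (≤⇒<punchIn v _ v≤σ₀))) (cong suc later-ascents)

  asc-insert-descent : σ ⟨$⟩ʳ 0F < v → asc (insert 0F v σ) ≡ asc σ
  asc-insert-descent σ₀<v = trans
    (cong length (filter-reject ascent? (ℕ.<⇒≱ σ₀<v ∘ <punchIn⇒≤ v _))) later-ascents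

-- Decoding words into permutations

-- The value of a first entry with (true) or without (false) a larger entry after it.
lead : Bool → Fin (suc (suc n))
lead false = fromℕ _
lead true  = inject₁ (fromℕ _)

toℕ-lead-true : toℕ (lead {n} true) ≡ n
toℕ-lead-true = trans (toℕ-inject₁ _) (toℕ-fromℕ _)

n≤lead : ∀ b → n ≤ toℕ (lead {n} b)
n≤lead false = ℕ.≤-trans (ℕ.n≤1+n _) (ℕ.≤-reflexive (sym (toℕ-fromℕ _)))
n≤lead true  = ℕ.≤-reflexive (sym toℕ-lead-true)

lead-injective : ∀ {b c} → lead {n} b ≡ lead c → b ≡ c
lead-injective {b = false} {false} _  = refl
lead-injective {b = false} {true}  eq = contradiction eq fromℕ≢inject₁
lead-injective {b = true}  {false} eq = contradiction (sym eq) fromℕ≢inject₁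
lead-injective {b = true}  {true}  _  = refl

-- The values `lead false` and `lead true` are n + 1 and n, the two largest available; excluding
-- them one after the other leaves v < n.
≢lead⇒<lead : {v : Fin (suc (suc n))} → (∀ b → v ≢ lead b) → ∀ b → v < lead b
≢lead⇒<lead {n} {v} v≢lead b = ℕ.<-≤-trans v<n (n≤lead b)
  where
  v≢ : ∀ c {t} → toℕ (lead {n} c) ≡ t → toℕ v ≢ t
  v≢ c lead≡t v≡t = v≢lead c (toℕ-injective (trans v≡t (sym lead≡t)))

  v<n : toℕ v ℕ.< n
  v<n = ℕ.≤∧≢⇒< (s≤s⁻¹ (ℕ.≤∧≢⇒< (s≤s⁻¹ (toℕ<n v)) (v≢ false (toℕ-fromℕ _))))
                (v≢ true toℕ-lead-true)

decode : Vec Bool n → Permutation′ (suc n)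
decode []      = id
decode (b ∷ w) = insert 0F (lead b) (decode w)

decode-injective : (w w′ : Vec Bool n) → decode w ≈ decode w′ → w ≡ w′
decode-injective []      []        _  = refl
decode-injective (b ∷ w) (b′ ∷ w′) eq with lead-injective {b = b} {b′} (eq 0F)
... | refl = cong (b ∷_) (decode-injective w w′ λ i → punchIn-injective (lead b) _ _ (eq (suc i)))

-- With `v` among the two largest values, an entry exceeding it can only come from the maximum `n`
-- of `σ`, which occurs at a single position.
atMostOneLargerAfter-insert : {v : Fin (suc (suc n))} (σ : Permutation′ (suc n)) →
  n ≤ toℕ v → AtMostOneLargerAfter σ → AtMostOneLargerAfter (insert 0F v σ)
atMostOneLargerAfter-insert {v = v} σ n≤v few {suc i} {suc j} {suc k} (s≤s i<j) (s≤s j<k) lt lt′ =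
  few i<j j<k (punchIn-cancel-< v lt) (punchIn-cancel-< v lt′)
atMostOneLargerAfter-insert {n} {v} σ n≤v few {zero} {suc j} {suc k} _ (s≤s j<k) lt lt′ =
  <-irrefl (⟨$⟩ʳ-injective σ (toℕ-injective (trans (maximal j lt) (sym (maximal k lt′))))) j<k
  where
  maximal : ∀ i → v < punchIn v (σ ⟨$⟩ʳ i) → toℕ (σ ⟨$⟩ʳ i) ≡ n
  maximal i v< = ℕ.≤-antisym (s≤s⁻¹ (toℕ<n _)) (ℕ.≤-trans n≤v (<punchIn⇒≤ v _ v<))

atMostOneLargerAfter-remove : (π : Permutation′ (suc n)) →
  AtMostOneLargerAfter π → AtMostOneLargerAfter (remove 0F π)
atMostOneLargerAfter-remove π few i<j j<k lt lt′ =
  few (s≤s i<j) (s≤s j<k) (lift lt) (lift lt′)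
  where
  lift : ∀ {i j} → remove 0F π ⟨$⟩ʳ i < remove 0F π ⟨$⟩ʳ j → π ⟨$⟩ʳ suc i < π ⟨$⟩ʳ suc j
  lift = subst₂ _<_ (insert-remove₀ π _) (insert-remove₀ π _) ∘ punchIn-mono-< (π ⟨$⟩ʳ 0F)

atMostOneLargerAfter-decode : (w : Vec Bool n) → AtMostOneLargerAfter (decode w)
atMostOneLargerAfter-decode [] {zero} {zero} ()
atMostOneLargerAfter-decode (b ∷ w) =
  atMostOneLargerAfter-insert (decode w) (n≤lead b) (atMostOneLargerAfter-decode w)

-- Otherwise both of the two largest values would stand after the first entry, in one order or the
-- other, and both would exceed it.
first≡lead : (π : Permutation′ (suc (suc n))) → AtMostOneLargerAfter π →
             ∃ λ b → π ⟨$⟩ʳ 0F ≡ lead b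
first≡lead π few with π ⟨$⟩ʳ 0F ≟ lead false | π ⟨$⟩ʳ 0F ≟ lead true
... | yes eq | _      = false , eq
... | no _   | yes eq = true , eq
... | no ≢f  | no ≢t  = ⊥-elim (impossible (<-cmp (position false) (position true)))
  where
  position : Bool → Fin _
  position b = π ⟨$⟩ˡ lead b

  below : ∀ b → π ⟨$⟩ʳ 0F < π ⟨$⟩ʳ position b
  below b = subst (π ⟨$⟩ʳ 0F <_) (sym (inverseʳ π)) (≢lead⇒<lead (λ { false → ≢f ; true → ≢t }) b)

  later : ∀ b → 0 ℕ.< toℕ (position b)
  later b with position b | below b
  ... | zero  | lt = contradiction lt (<-irrefl refl)
  ... | suc _ | _  = s≤s z≤n

  impossible : _ → ⊥
  impossible (tri< lt _ _) = few (later false) lt (below false) (below true)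
  impossible (tri> _ _ lt) = few (later true) lt (below true) (below false)
  impossible (tri≈ _ eq _) = contradiction
    (trans (sym (inverseʳ π)) (trans (cong (π ⟨$⟩ʳ_) eq) (inverseʳ π))) fromℕ≢inject₁

-- The first entry determines the first bit; removing it keeps the condition, so the remaining bits
-- follow by induction.
decode-surjective : (π : Permutation′ (suc n)) → AtMostOneLargerAfter π →
                    ∃ λ (w : Vec Bool n) → decode w ≈ π
decode-surjective {zero} π few = [] , λ { zero → unique (π ⟨$⟩ʳ 0F) }
  where
  unique : (i : Fin 1) → 0F ≡ i
  unique zero = refl
decode-surjective {suc n} π few
  with b , π₀≡lead ← first≡lead π few
  with w , w≈ ← decode-surjective (remove 0F π) (atMostOneLargerAfter-remove π few) =
  b ∷ w , λ
    { zero    → sym π₀≡lead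
    ; (suc i) → trans (cong₂ punchIn (sym π₀≡lead) (w≈ i)) (insert-remove₀ π (suc i))
    }

-- The number of descents 10 in the word b w 0.
descents : Bool → Vec Bool n → ℕ
descents false []          = 0
descents true  []          = 1
descents false (b ∷ w)     = descents b w
descents true  (true ∷ w)  = descents true w
descents true  (false ∷ w) = suc (descents false w)

-- A leading 0 puts the maximum first, which gives no ascent. After a leading 1 the only larger
-- entry is the maximum of the rest, and it comes next exactly when the next bit is 0 or a single
-- entry remains; the latter is the final 0.
asc-decode : (w : Vec Bool n) → asc (decode w) ≡ descents false w
asc-decode []          = refl
asc-decode (false ∷ w) = trans
  (asc-insert-descent (lead false) (decode w)
    (subst (toℕ (decode w ⟨$⟩ʳ 0F) ℕ.<_) (sym (toℕ-fromℕ _)) (toℕ<n _)))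
  (asc-decode w)
asc-decode (true ∷ []) = refl
asc-decode (true ∷ false ∷ w) = trans
  (asc-insert-ascent (lead true) (decode (false ∷ w)) (ℕ.≤-reflexive (toℕ-inject₁ _)))
  (cong suc (asc-decode (false ∷ w)))
asc-decode (true ∷ true ∷ w) = trans
  (asc-insert-descent (lead true) (decode (true ∷ w))
    (ℕ.≤-reflexive (trans (cong suc toℕ-lead-true) (sym toℕ-lead-true))))
  (asc-decode (true ∷ w))

-- Counting words

Words : Bool → ℕ → ℕ → Set
Words b n k = Σ (Vec Bool n) λ w → descents b w ≡ k

fibre-≡ : (f : A → ℕ) {x y : Σ A λ a → f a ≡ k} → proj₁ x ≡ proj₁ y → x ≡ y
fibre-≡ f {x , p} {.x , q} refl = cong (x ,_) (ℕ.≡-irrelevant p q)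

avoiders-inverse-Words : ∀ n k →
  Inverse (avoidersWithAsc p123 p132 (suc n) k) (setoid (Words false n k))
avoiders-inverse-Words n k = record
  { to        = to
  ; from      = from
  -- The word is extracted using the avoidance proofs; injectivity of `decode` shows that it depends
  -- on the values alone.
  ; to-cong   = λ {x} {y} x≈y → fibre-≡ (descents false) (decode-injective _ _ λ i →
                  trans (decode-to x i) (trans (x≈y i) (sym (decode-to y i))))
  ; from-cong = λ { refl _ → refl }
  ; inverse   = (λ {w} {x} x≈w →
      fibre-≡ (descents false) (decode-injective _ _ λ i → trans (decode-to x i) (x≈w i)))
              , (λ { {x} refl → decode-to x })
  }
  where
  Avoiders : Set
  Avoiders = Σ (Permutation′ (suc n)) λ π → Avoids p123 π × Avoids p132 π × asc π ≡ k

  word : (x : Avoiders) → ∃ λ (w : Vec Bool n) → decode w ≈ proj₁ x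
  word (π , av123 , av132 , _) = decode-surjective π (avoids⇒atMostOneLargerAfter π av123 av132)

  to : Avoiders → Words false n k
  to x@(π , _ , _ , asc≡k) =
    let w , w≈π = word x
    in w , trans (sym (asc-decode w)) (trans (asc-cong (decode w) π w≈π) asc≡k)

  decode-to : (x : Avoiders) → decode (proj₁ (to x)) ≈ proj₁ x
  decode-to x = proj₂ (word x)

  from : Words false n k → Avoiders
  from (w , p) = decode w
    , atMostOneLargerAfter⇒avoids p123 (s≤s z≤n) (s≤s z≤n) (decode w) few
    , atMostOneLargerAfter⇒avoids p132 (s≤s z≤n) (s≤s z≤n) (decode w) few
    , trans (asc-decode w) p
    where
    few : AtMostOneLargerAfter (decode w)
    few = atMostOneLargerAfter-decode w

-- Recursion on the first bit and Pascal's rule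

uncons↔ : (P : Vec Bool (suc n) → Set) →
          Σ (Vec Bool (suc n)) P ↔ (Σ (Vec Bool n) (P ∘ (true ∷_)) ⊎ Σ (Vec Bool n) (P ∘ (false ∷_)))
uncons↔ P = mk↔ₛ′
  (λ { (true ∷ w , p) → inj₁ (w , p) ; (false ∷ w , p) → inj₂ (w , p) })
  (λ { (inj₁ (w , p)) → true ∷ w , p ; (inj₂ (w , p)) → false ∷ w , p })
  (λ { (inj₁ _) → refl ; (inj₂ _) → refl })
  (λ { (true ∷ _ , _) → refl ; (false ∷ _ , _) → refl })

suc-Words↔ : Σ (Vec Bool n) (λ w → suc (descents false w) ≡ suc k) ↔ Words false n k
suc-Words↔ = mk↔ₛ′ (map₂ ℕ.suc-injective) (map₂ (cong suc))
  (λ _ → fibre-≡ (descents false) refl) (λ _ → fibre-≡ (suc ∘ descents false) refl)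

-- The leading run of 1s must end, at the latest at the final 0, and its end is a descent.
descents-true≢0 : (w : Vec Bool n) → descents true w ≢ 0
descents-true≢0 (true ∷ w) = descents-true≢0 w

Fin-Pascal↔ : ∀ n k → (Fin (n C k) ⊎ Fin (n C suc k)) ↔ Fin (suc n C suc k)
Fin-Pascal↔ n k = ↔-trans (↔-sym +↔⊎) (cast-id (nCk+nC[k+1]≡[n+1]C[k+1] n k))

empty↔ : ¬ A → A ↔ Fin 0
empty↔ ¬a = mk↔ₛ′ (⊥-elim ∘ ¬a) (λ ()) (λ ()) (⊥-elim ∘ ¬a)

⊎-emptyˡ↔ : ¬ A → (A ⊎ B) ↔ B
⊎-emptyˡ↔ ¬a = mk↔ₛ′ (λ { (inj₁ a) → contradiction a ¬a ; (inj₂ b) → b }) inj₂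
  (λ _ → refl) (λ { (inj₁ a) → contradiction a ¬a ; (inj₂ _) → refl })

Words-zero↔ : ∀ b → Words b 0 (descents b []) ↔ Fin 1
Words-zero↔ b = mk↔ₛ′ (λ _ → zero) (λ _ → [] , refl)
  (λ { zero → refl }) (λ { ([] , _) → fibre-≡ (descents b) refl })

-- In b w 0 the changes of value alternate and the last one is a descent, so k descents mean 2k
-- changes for b = 0, and k + 1 descents mean 2k + 1 changes for b = 1, among n + 1 boundaries.
-- Pascal's rule splits on whether the first boundary is a change.
Words-false↔ : ∀ n k → Words false n k ↔ Fin (suc n C (2 * k))
Words-true↔  : ∀ n k → Words true n (suc k) ↔ Fin (suc n C suc (2 * k))

Words-false↔ zero zero = Words-zero↔ false
Words-false↔ zero (suc k) = ↔-trans (empty↔ λ { ([] , ()) })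
  (cast-id (sym (k>n⇒nCk≡0 (subst (1 ℕ.<_) (sym (ℕ.*-suc 2 k)) (s≤s (s≤s z≤n))))))
Words-false↔ (suc n) zero = ↔-trans (uncons↔ _)
  -- A first bit 1 would force a descent. Both binomials with lower index 0 compute to 1, so the
  -- types agree without a cast.
  (↔-trans (⊎-emptyˡ↔ λ { (w , p) → descents-true≢0 w p }) (Words-false↔ n 0))
Words-false↔ (suc n) (suc k) = ↔-trans (uncons↔ _) (↔-trans
  (Words-true↔ n k ⊎-↔
    -- Writing `2 * suc k` as `2 + 2 * k` makes it the successor of the other lower index, as
    -- Pascal's rule requires.
    ↔-trans (Words-false↔ n (suc k)) (cast-id (cong (suc n C_) (ℕ.*-suc 2 k))))
  (↔-trans (Fin-Pascal↔ (suc n) (suc (2 * k)))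
    (cast-id (cong (suc (suc n) C_) (sym (ℕ.*-suc 2 k))))))

Words-true↔ zero zero = Words-zero↔ true
Words-true↔ zero (suc k) = ↔-trans (empty↔ λ { ([] , ()) })
  (cast-id (sym (k>n⇒nCk≡0 {1} {suc (2 * suc k)} (s≤s (s≤s z≤n)))))
-- After a 1 it is the first bit 0 that changes the value, so the summands are swapped to put the
-- smaller lower index first.
Words-true↔ (suc n) k = ↔-trans (uncons↔ _) (↔-trans (⊎-comm _ _) (↔-trans
  (↔-trans suc-Words↔ (Words-false↔ n k) ⊎-↔ Words-true↔ n k)
  (Fin-Pascal↔ (suc n) (2 * k))))

proposition13 : (n k : ℕ) → 1 ≤ n →
    HasCardinality (avoidersWithAsc p123 p132 n k) (n C (2 * k))
proposition13 (suc n) k _ = inverse (avoiders-inverse-Words n k) (Words-false↔ n k)
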